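{- Let $\phi$ be a propositional CNF formula and run Algorithm 1 (described in the context) on $\phi$ with an arbitrary decomposition $\psi_1,\dots,\psi_k$. If the algorithm returns $\top$, then $\phi$ is satisfiable; if it returns $\bot$, then $\phi$ is unsatisfiable.
   Context: A formula in CNF is a conjunction of clauses (disjunctions of literals); $V_\chi$ denotes the set of variables of $\chi$. Given formulas $A,B$ with $A\wedge B$ unsatisfiable, an interpolant for $\neg(A\wedge B)$ is a formula $I$ with $A\Rightarrow I$, $I\Rightarrow\neg B$, and $V_I\subseteq V_A\cap V_B$. Algorithm 1: decompose $\phi$ into formulas $\psi_1,\dots,\psi_k$, each being a conjunction of clauses of $\phi$, with $\phi\equiv\psi_1\wedge\dots\wedge\psi_k$ (no requirement that they share no variables). Let $V=\bigcup_{i\neq j}(V_{\psi_i}\cap V_{\psi_j})$ be the shared variables. Set $G:=\top$ and repeat: if $G$ is unsatisfiable, return $\bot$; otherwise pick an assignment $m$ to all variables of $V$ satisfying $G$ (viewed as a conjunction of literals). For each $i=1,\dots,k$: if $\psi_i\wedge m$ is unsatisfiable, compute an interpolant $I$ for $\neg(\psi_i\wedge m)$ (so its variables lie in $V_{\psi_i}\cap V$) and set $G:=G\wedge I$. If no $\psi_i\wedge m$ was unsatisfiable in this round, return $\top$; otherwise repeat. -}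

module Defs where

open import Data.Bool.Base using (Bool; true; false; not; _∧_; _∨_)
open import Data.List.Base using (List; []; _∷_; [_]; _++_; map; foldr)
open import Data.List.Membership.Propositional using (_∈_)
open import Data.List.Relation.Binary.Subset.Propositional using (_⊆_)
open import Data.List.Relation.Unary.Unique.Propositional using (Unique)
open import Data.Nat.Base using (ℕ)
open import Data.Product.Base using (_×_; ∃-syntax)
open import Data.Vec.Base using (Vec; []; _∷_; lookup; toList)
open import Function.Bundles using (_⇔_)
open import Relation.Binary.PropositionalEquality.Core using (_≡_; _≢_)
open import Relation.Nullary.Negation.Core using (¬_)

infix  9 ¬ᶠ_
infixr 7 _∧ᶠ_
infixr 6 _∨ᶠ_
infix  4 _⊨_ _⇒_ _≣_

data Formula (Var : Set) : Set where
  var       : Var → Formula Var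
  ⊤ᶠ ⊥ᶠ     : Formula Var
  ¬ᶠ_       : Formula Var → Formula Var
  _∧ᶠ_ _∨ᶠ_ : Formula Var → Formula Var → Formula Var

data Literal (Var : Set) : Set where
  pos neg : Var → Literal Var

Clause : Set → Set
Clause Var = List (Literal Var)

CNF : Set → Set
CNF Var = List (Clause Var)

private
  variable
    Var : Set
    k : ℕ

⋀ ⋁ : List (Formula Var) → Formula Var
⋀ = foldr _∧ᶠ_ ⊤ᶠ
⋁ = foldr _∨ᶠ_ ⊥ᶠ

literal : Literal Var → Formula Var
literal (pos x) = var x
literal (neg x) = ¬ᶠ var x

clause : Clause Var → Formula Var
clause c = ⋁ (map literal c)

cnf : CNF Var → Formula Var
cnf χ = ⋀ (map clause χ)

vars : Formula Var → List Var
vars (var x)  = [ x ]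
vars ⊤ᶠ       = []
vars ⊥ᶠ       = []
vars (¬ᶠ A)   = vars A
vars (A ∧ᶠ B) = vars A ++ vars B
vars (A ∨ᶠ B) = vars A ++ vars B

eval : (Var → Bool) → Formula Var → Bool
eval α (var x)  = α x
eval α ⊤ᶠ       = true
eval α ⊥ᶠ       = false
eval α (¬ᶠ A)   = not (eval α A)
eval α (A ∧ᶠ B) = eval α A ∧ eval α B
eval α (A ∨ᶠ B) = eval α A ∨ eval α B

_⊨_ : (Var → Bool) → Formula Var → Set
α ⊨ A = eval α A ≡ true

Satisfiable Unsatisfiable : Formula Var → Set
Satisfiable A   = ∃[ α ] α ⊨ A
Unsatisfiable A = ¬ Satisfiable A

_⇒_ _≣_ : Formula Var → Formula Var → Set
A ⇒ B = ∀ α → α ⊨ A → α ⊨ B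
A ≣ B = ∀ α → (α ⊨ A) ⇔ (α ⊨ B)

record Interpolant (A B I : Formula Var) : Set where
  field
    implied : A ⇒ I
    refutes : I ⇒ ¬ᶠ B
    shared  : ∀ x → x ∈ vars I → x ∈ vars A × x ∈ vars B

record Decomposition (φ : CNF Var) (ψs : Vec (CNF Var) k) : Set where
  field
    clauses    : ∀ i → lookup ψs i ⊆ φ
    equivalent : cnf φ ≣ ⋀ (map cnf (toList ψs))

Shared : Vec (CNF Var) k → Var → Set
Shared ψs x = ∃[ i ] ∃[ j ] i ≢ j × x ∈ vars (cnf (lookup ψs i)) × x ∈ vars (cnf (lookup ψs j))

-- A partial assignment, given by the literals it makes true.
Cube : Set → Set
Cube Var = List (Literal Var)

variable-of : Literal Var → Var
variable-of (pos x) = x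
variable-of (neg x) = x

cube : Cube Var → Formula Var
cube m = ⋀ (map literal m)

-- m assigns exactly one value to each variable in V, and none to any other.
record AssignmentTo (V : Var → Set) (m : Cube Var) : Set where
  field
    domain     : ∀ x → (x ∈ map variable-of m) ⇔ V x
    consistent : Unique (map variable-of m)

-- ForEach m ψs G G′ b: with the assignment m, the inner loop over ψs can turn
-- G into G′; b records whether some ψ ∧ m was found unsatisfiable.
data ForEach (m : Cube Var) : Vec (CNF Var) k → Formula Var → Formula Var → Bool → Set where
  done   : ∀ {G} → ForEach m [] G G false
  skip   : ∀ {ψ G G′ b} {ψs : Vec (CNF Var) k} →
           ¬ Unsatisfiable (cnf ψ ∧ᶠ cube m) →
           ForEach m ψs G G′ b →
           ForEach m (ψ ∷ ψs) G G′ b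
  refine : ∀ {ψ G G′ b I} {ψs : Vec (CNF Var) k} →
           Unsatisfiable (cnf ψ ∧ᶠ cube m) →
           Interpolant (cnf ψ) (cube m) I →
           ForEach m ψs (G ∧ᶠ I) G′ b →
           ForEach m (ψ ∷ ψs) G G′ true

data Output : Set where
  out-⊤ out-⊥ : Output

-- A partial assignment m to the shared variables satisfies G when cube m ⇒ G;
-- since vars G stays within the shared variables, m determines G's value.
record Pick (ψs : Vec (CNF Var) k) (G : Formula Var) (m : Cube Var) : Set where
  field
    assignment : AssignmentTo (Shared ψs) m
    satisfies  : cube m ⇒ G

-- Loop ψs G o: some terminating execution of the outer loop entered with the
-- given G returns o. The choices of m and of the interpolants are arbitrary.
data Loop (ψs : Vec (CNF Var) k) : Formula Var → Output → Set where
  return-⊥ : ∀ {G} → Unsatisfiable G → Loop ψs G out-⊥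
  return-⊤ : ∀ {G G′ m} →
             ¬ Unsatisfiable G →
             Pick ψs G m →
             ForEach m ψs G G′ false →
             Loop ψs G out-⊤
  repeat   : ∀ {G G′ m o} →
             ¬ Unsatisfiable G →
             Pick ψs G m →
             ForEach m ψs G G′ true →
             Loop ψs G′ o →
             Loop ψs G o

Algorithm1 : Vec (CNF Var) k → Output → Set
Algorithm1 ψs o = Loop ψs ⊤ᶠ o

{-# OPTIONS --safe #-}

-- Every interpolant added to G is implied by some ψᵢ, so φ ⇒ G throughout; hence
-- φ is unsatisfiable once G is. If no ψᵢ ∧ m is unsatisfiable, pick a model αᵢ of
-- each. Any two of them agree on the shared variables, where both are given by m,
-- so they glue to an assignment that agrees with αᵢ on vars ψᵢ for every i, and
-- this assignment satisfies φ.

module Submission where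

open import Defs
open import Data.Bool.Base using (Bool; true; false; not; _∧_; _∨_)
open import Data.Bool.Properties using (∧-conicalˡ; ∧-conicalʳ; not-injective) renaming (_≟_ to _≟ᵇ_)
open import Data.Fin.Base using (Fin; zero; suc)
open import Data.Fin.Properties using (any?) renaming (_≟_ to _≟ᶠ_)
open import Data.List.Base using (List; []; _∷_; [_]; map; cartesianProductWith)
import Data.List.Membership.DecPropositional as DecMembership
open import Data.List.Membership.Propositional using (_∈_; find; lose)
open import Data.List.Membership.Propositional.Properties using (∈-++⁺ˡ; ∈-++⁺ʳ; ∈-cartesianProductWith⁺)
open import Data.List.Relation.Unary.Any as Any using (here; there)
open import Data.Nat.Base using (ℕ)
open import Data.Product.Base using (_×_; _,_; proj₁; proj₂; ∃-syntax)
open import Data.Vec.Base using (Vec; []; _∷_; lookup; toList)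
open import Function.Base using (_∘_)
open import Function.Bundles using (Equivalence)
open import Relation.Binary.Definitions using (DecidableEquality)
open import Relation.Binary.PropositionalEquality using (_≡_; refl; sym; trans; cong; cong₂)
open import Relation.Nullary.Decidable using (Dec; yes; no; map′; decidable-stable)
open import Relation.Nullary.Negation using (¬_; contradiction)

private
  variable
    Var : Set
    k : ℕ

eval-cong : ∀ {α β : Var → Bool} A → (∀ {x} → x ∈ vars A → α x ≡ β x) → eval α A ≡ eval β A
eval-cong (var x)  α≗β = α≗β (here refl)
eval-cong ⊤ᶠ       α≗β = refl
eval-cong ⊥ᶠ       α≗β = refl
eval-cong (¬ᶠ A)   α≗β = cong not (eval-cong A α≗β)
eval-cong (A ∧ᶠ B) α≗β =
  cong₂ _∧_ (eval-cong A (α≗β ∘ ∈-++⁺ˡ)) (eval-cong B (α≗β ∘ ∈-++⁺ʳ (vars A)))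
eval-cong (A ∨ᶠ B) α≗β =
  cong₂ _∨_ (eval-cong A (α≗β ∘ ∈-++⁺ˡ)) (eval-cong B (α≗β ∘ ∈-++⁺ʳ (vars A)))

⊨-∧⁻ : ∀ {α : Var → Bool} A B → α ⊨ A ∧ᶠ B → α ⊨ A × α ⊨ B
⊨-∧⁻ {α = α} A B αAB = ∧-conicalˡ (eval α A) (eval α B) αAB , ∧-conicalʳ (eval α A) (eval α B) αAB

module Decidability (_≟_ : DecidableEquality Var) where

  _[_≔_] : (Var → Bool) → Var → Bool → Var → Bool
  (α [ x ≔ b ]) y with y ≟ x
  ... | yes _ = b
  ... | no  _ = α y

  assignments : List Var → List (Var → Bool)
  assignments []       = [ (λ _ → false) ]
  assignments (x ∷ xs) = cartesianProductWith (λ b α → α [ x ≔ b ]) (true ∷ false ∷ []) (assignments xs)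

  -- `Var` may be infinite and functions are not compared extensionally, so the finite list can only
  -- match `α` up to agreement on `xs`. By `eval-cong` this is enough for a formula whose variables
  -- lie in `xs`.
  assignments-complete : ∀ xs (α : Var → Bool) →
    ∃[ β ] β ∈ assignments xs × (∀ {y} → y ∈ xs → β y ≡ α y)
  assignments-complete []       α = (λ _ → false) , here refl , λ ()
  assignments-complete (x ∷ xs) α with assignments-complete xs α
  ... | β , β∈ , β≗α = β [ x ≔ α x ] , ∈-cartesianProductWith⁺ (λ b γ → γ [ x ≔ b ]) (∈-bools (α x)) β∈ , agree
    where
    ∈-bools : ∀ b → b ∈ true ∷ false ∷ []
    ∈-bools true  = here refl
    ∈-bools false = there (here refl)

    agree : ∀ {y} → y ∈ x ∷ xs → (β [ x ≔ α x ]) y ≡ α y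
    agree {y} y∈ with y ≟ x
    ... | yes y≡x = cong α (sym y≡x)
    ... | no  y≢x = β≗α (Any.tail y≢x y∈)

  -- Truth tables: only the values on `vars A` matter. The decision is what turns the
  -- `¬ Unsatisfiable` recorded by the algorithm, a double negation, into an actual model.
  satisfiable? : ∀ A → Dec (Satisfiable A)
  satisfiable? A = map′ from to (Any.any? (λ α → eval α A ≟ᵇ true) (assignments (vars A)))
    where
    from : Any.Any (_⊨ A) (assignments (vars A)) → Satisfiable A
    from p = let α , _ , α⊨A = find p in α , α⊨A

    to : Satisfiable A → Any.Any (_⊨ A) (assignments (vars A))
    to (α , α⊨A) =
      let β , β∈ , β≗α = assignments-complete (vars A) α
      in lose β∈ (trans (eval-cong A β≗α) α⊨A)

literal-determines : ∀ {α β : Var → Bool} l → α ⊨ literal l → β ⊨ literal l →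
  α (variable-of l) ≡ β (variable-of l)
literal-determines (pos x) αl βl = trans αl (sym βl)
literal-determines (neg x) αl βl = not-injective (trans αl (sym βl))

cube-determines : ∀ {α β : Var → Bool} {x} m → α ⊨ cube m → β ⊨ cube m →
  x ∈ map variable-of m → α x ≡ β x
cube-determines {α = α} {β} (l ∷ m) αlm βlm (here refl) =
  literal-determines {α = α} {β} l (proj₁ (⊨-∧⁻ (literal l) (cube m) αlm)) (proj₁ (⊨-∧⁻ (literal l) (cube m) βlm))
cube-determines (l ∷ m) αlm βlm (there x∈m) =
  cube-determines m (proj₂ (⊨-∧⁻ (literal l) (cube m) αlm)) (proj₂ (⊨-∧⁻ (literal l) (cube m) βlm)) x∈m

⋀cnf : Vec (CNF Var) k → Formula Var
⋀cnf ψs = ⋀ (map cnf (toList ψs))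

⋀cnf-lookup⁺ : ∀ {α : Var → Bool} (ψs : Vec (CNF Var) k) →
  (∀ i → α ⊨ cnf (lookup ψs i)) → α ⊨ ⋀cnf ψs
⋀cnf-lookup⁺ []       αψs = refl
⋀cnf-lookup⁺ (ψ ∷ ψs) αψs = cong₂ _∧_ (αψs zero) (⋀cnf-lookup⁺ ψs (αψs ∘ suc))

-- Each conjunct added is implied by its `ψ`, which `α` satisfies. `G` varies along the induction
-- because it accumulates the interpolants.
forEach-⇒ : ∀ {m} {ψs : Vec (CNF Var) k} {G G′ b} → ForEach m ψs G G′ b →
  ∀ {α} → α ⊨ ⋀cnf ψs → α ⊨ G → α ⊨ G′
forEach-⇒ done αψs αG = αG
forEach-⇒ (skip {ψ = ψ} {ψs = ψs} _ run) αψs αG = forEach-⇒ run (proj₂ (⊨-∧⁻ (cnf ψ) (⋀cnf ψs) αψs)) αG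
forEach-⇒ (refine {ψ = ψ} {ψs = ψs} _ itp run) {α} αψs αG with ⊨-∧⁻ (cnf ψ) (⋀cnf ψs) αψs
... | αψ , αψs′ = forEach-⇒ run αψs′ (cong₂ _∧_ αG (Interpolant.implied itp α αψ))

-- The flag `false` excludes `refine`, so every `ψ` was skipped.
forEach-false : ∀ {m} {ψs : Vec (CNF Var) k} {G G′} → ForEach m ψs G G′ false →
  ∀ i → ¬ Unsatisfiable (cnf (lookup ψs i) ∧ᶠ cube m)
forEach-false (skip ¬unsat run) zero    = ¬unsat
forEach-false (skip ¬unsat run) (suc i) = forEach-false run i

-- The hypothesis on `G` is the loop invariant, preserved by each round through `forEach-⇒`.
loop-⊥ : ∀ {ψs : Vec (CNF Var) k} {G} → Loop ψs G out-⊥ →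
  ⋀cnf ψs ⇒ G → Unsatisfiable (⋀cnf ψs)
loop-⊥ (return-⊥ unsat)    ψs⇒G (α , αψs) = unsat (α , ψs⇒G α αψs)
loop-⊥ (repeat _ _ run lp) ψs⇒G = loop-⊥ lp (λ α αψs → forEach-⇒ run αψs (ψs⇒G α αψs))

-- The witness `m` is the assignment picked in the last round, the one that refines nothing.
loop-⊤ : ∀ {ψs : Vec (CNF Var) k} {G} → Loop ψs G out-⊤ →
  ∃[ m ] AssignmentTo (Shared ψs) m × (∀ i → ¬ Unsatisfiable (cnf (lookup ψs i) ∧ᶠ cube m))
loop-⊤ (return-⊤ _ pick run) = _ , Pick.assignment pick , forEach-false run
loop-⊤ (repeat _ _ _ lp)     = loop-⊤ lp

module Gluing (_≟_ : DecidableEquality Var) (ψs : Vec (CNF Var) k) (α : Fin k → Var → Bool) where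

  open DecMembership _≟_ using (_∈?_)

  glue : Var → Bool
  glue x with any? (λ i → x ∈? vars (cnf (lookup ψs i)))
  -- Any index whose formula contains `x` will do once the `α i` agree on shared variables; a
  -- variable in no formula gets the default `false`.
  ... | yes (i , _) = α i x
  ... | no  _       = false

  glue-agrees : (∀ {x} → Shared ψs x → ∀ i j → α i x ≡ α j x) →
    ∀ j {x} → x ∈ vars (cnf (lookup ψs j)) → glue x ≡ α j x
  glue-agrees compatible j {x} x∈ψⱼ with any? (λ i → x ∈? vars (cnf (lookup ψs i)))
  ... | no  ∄i = contradiction (j , x∈ψⱼ) ∄i
  ... | yes (i , x∈ψᵢ) with i ≟ᶠ j
  ...   | yes refl = refl
  -- Occurring in two formulas with distinct indices is exactly what makes `x` shared.
  ...   | no  i≢j  = compatible (i , j , i≢j , x∈ψᵢ , x∈ψⱼ) i j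

satisfiable-⋀ : DecidableEquality Var → (ψs : Vec (CNF Var) k) → ∀ {m} → AssignmentTo (Shared ψs) m →
  (∀ i → Satisfiable (cnf (lookup ψs i) ∧ᶠ cube m)) → Satisfiable (⋀cnf ψs)
satisfiable-⋀ _≟_ ψs {m} assigns sat = glue , ⋀cnf-lookup⁺ ψs λ i →
  trans (eval-cong (cnf (lookup ψs i)) (glue-agrees compatible i)) (proj₁ (models i))
  where
  open Gluing _≟_ ψs (proj₁ ∘ sat)

  models : ∀ i → proj₁ (sat i) ⊨ cnf (lookup ψs i) × proj₁ (sat i) ⊨ cube m
  models i = ⊨-∧⁻ (cnf (lookup ψs i)) (cube m) (proj₂ (sat i))

  compatible : ∀ {x} → Shared ψs x → ∀ i j → proj₁ (sat i) x ≡ proj₁ (sat j) x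
  -- `m` assigns every shared variable, and both models satisfy `cube m`.
  compatible {x} shared i j = cube-determines m (proj₂ (models i)) (proj₂ (models j))
    (Equivalence.from (AssignmentTo.domain assigns x) shared)

mainTheorem2 : {Var : Set} → DecidableEquality Var → (φ : CNF Var) {k : ℕ} (ψs : Vec (CNF Var) k) →
    Decomposition φ ψs →
    (Algorithm1 ψs out-⊤ → Satisfiable (cnf φ)) × (Algorithm1 ψs out-⊥ → Unsatisfiable (cnf φ))
mainTheorem2 _≟_ φ ψs dec = sound-⊤ , sound-⊥
  where
  open Decidability _≟_
  open Decomposition dec

  sound-⊤ : Algorithm1 ψs out-⊤ → Satisfiable (cnf φ)
  sound-⊤ run =
    let m , assigns , ¬unsat = loop-⊤ run
        α , αψs = satisfiable-⋀ _≟_ ψs assigns (λ i → decidable-stable (satisfiable? (cnf (lookup ψs i) ∧ᶠ cube m)) (¬unsat i))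
    in α , Equivalence.from (equivalent α) αψs

  sound-⊥ : Algorithm1 ψs out-⊥ → Unsatisfiable (cnf φ)
  -- The invariant holds at the start since `G` is `⊤ᶠ`.
  sound-⊥ run (α , αφ) = loop-⊥ run (λ _ _ → refl) (α , Equivalence.to (equivalent α) αφ)
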